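{- For every $n\ge1$ and every Boolean function $f:\{0,1\}^n\to\{0,1\}$, $\mathsf{EC}(f)\le 3n-1$.
   Context: A Boolean circuit $C$ over the basis $\mathcal{B}=\{\land_2,\lor_2,\lnot\}$ (AND and OR of fan-in 2, and NOT) is a directed acyclic graph with a root node of out-degree zero, input gates (in-degree zero) labeled by variables $x_1,\dots,x_n$, and non-input gates (including the root) labeled by functions in $\mathcal{B}$; gates may have arbitrary fan-out. For $a\in\{0,1\}^n$, $\mathsf{EC}(C,a)$ is the number of non-input gates of $C$ that output $1$ on $a$; $\mathsf{EC}(C)=\max_a\mathsf{EC}(C,a)$; $\mathsf{EC}(f)$ is the minimum of $\mathsf{EC}(C)$ over all circuits $C$ over $\mathcal{B}$ computing $f$. -}

module Defs where

open import Data.Bool using (Bool; true; false; not; _∧_; _∨_; _≟_)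
open import Data.Fin using (Fin)
open import Data.Nat using (ℕ; zero; suc; _≤_; _⊔_)
open import Data.Product using (_×_; _,_; ∃-syntax)
open import Data.Sum using (_⊎_; [_,_]′)
open import Data.Vec using (Vec; []; _∷_; lookup; head; count)
open import Relation.Binary.PropositionalEquality using (_≡_)

-- The nodes available as predecessors of a gate: an input gate, identified
-- with its variable, or one of s earlier non-input gates.
Node : ℕ → ℕ → Set
Node n s = Fin n ⊎ Fin s

data Gate (n s : ℕ) : Set where
  AND OR : Node n s → Node n s → Gate n s
  NOT    : Node n s → Gate n s

infixl 5 _▷_

-- A directed acyclic graph with s non-input gates, listed in a topological
-- order: each gate reads only inputs and earlier gates, and may be read any
-- number of times.  Gates are numbered backwards, so zero is the latest one.
data Gates (n : ℕ) : ℕ → Set where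
  []  : Gates n zero
  _▷_ : ∀ {s} → Gates n s → Gate n s → Gates n (suc s)

-- The root is a non-input gate of out-degree zero, so it can always be placed
-- last in the topological order; conversely nothing can read the last gate.
record Circuit (n : ℕ) : Set where
  constructor circuit
  field
    {size} : ℕ
    gates  : Gates n (suc size)

nodeValue : ∀ {n s} → Vec Bool n → Vec Bool s → Node n s → Bool
nodeValue a v = [ lookup a , lookup v ]′

gateValue : ∀ {n s} → Vec Bool n → Vec Bool s → Gate n s → Bool
gateValue a v (AND p q) = nodeValue a v p ∧ nodeValue a v q
gateValue a v (OR p q)  = nodeValue a v p ∨ nodeValue a v q
gateValue a v (NOT p)   = not (nodeValue a v p)

values : ∀ {n s} → Gates n s → Vec Bool n → Vec Bool s
values []       a = []
values (gs ▷ g) a = gateValue a (values gs a) g ∷ values gs a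

output : ∀ {n} → Circuit n → Vec Bool n → Bool
output C a = head (values (Circuit.gates C) a)

_Computes_ : ∀ {n} → Circuit n → (Vec Bool n → Bool) → Set
C Computes f = ∀ a → output C a ≡ f a

ECAt : ∀ {n} → Circuit n → Vec Bool n → ℕ
ECAt C a = count (_≟ true) (values (Circuit.gates C) a)

maxOverInputs : ∀ n → (Vec Bool n → ℕ) → ℕ
maxOverInputs zero    h = h []
maxOverInputs (suc n) h =
  maxOverInputs n (λ a → h (false ∷ a)) ⊔ maxOverInputs n (λ a → h (true ∷ a))

EC : ∀ {n} → Circuit n → ℕ
EC {n} C = maxOverInputs n (ECAt C)

IsMinimum : (ℕ → Set) → ℕ → Set
IsMinimum P k = P k × (∀ m → P m → k ≤ m)

-- "EC(f) = k".  A relation rather than a function, because the minimum ranges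
-- over infinitely many circuits.
IsEC : ∀ {n} → (Vec Bool n → Bool) → ℕ → Set
IsEC {n} f = IsMinimum (λ m → ∃[ C ] (C Computes f × EC {n} C ≡ m))

{-# OPTIONS --safe #-}

-- Upper bound.  After computing all n negated literals and a constant 0 gate
-- x ∧ ¬x, build the complete binary tree of prefix conjunctions and, mirroring
-- it, a tree of disjunctions collecting the minterms of f.  On a given input
-- only one root-to-leaf path is active: it contributes n - 1 conjunctions (a
-- prefix of length 1 is a literal) and at most n disjunctions.
--
-- The minimum is attained.  Gates below the root that compute the same function
-- can be merged without raising the energy on any input, so a circuit can be
-- assumed to have at most 2 ^ 2 ^ n gates below the root, and the search for
-- the least energy is finite.
module Submission where

open import Data.Bool using (Bool; true; false; not; _∧_; _∨_; _≟_; if_then_else_)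
open import Data.Bool.Properties using (∧-identityʳ; ∧-zeroʳ; ∧-inverseʳ)
open import Data.Fin using (Fin; zero; suc; finToFun; funToFin)
open import Data.Fin.Properties as Fin using (2↔Bool; any?; all?; finToFun-funToFin; injective⇒≤)
open import Data.Nat using (ℕ; zero; suc; _+_; _*_; _∸_; _^_; _≤_; _<_; _≥_; z≤n; s≤s)
open import Data.Nat.Properties as ℕ using (anyUpTo?; ≤-refl; ≤-reflexive; ≤-trans; +-mono-≤; +-monoʳ-≤; +-monoˡ-≤; ⊔-lub; m≤m⊔n; m≤n⊔m; +-assoc; module ≤-Reasoning)
open import Data.Nat.Tactic.RingSolver using (solve-∀)
open import Data.Product using (_×_; _,_; ∃; ∃-syntax; proj₁; proj₂)
open import Data.Sum using (_⊎_; inj₁; inj₂; [_,_]′)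
open import Data.Vec using (Vec; []; _∷_; lookup; tabulate; count)
open import Data.Vec.Properties using (tabulate∘lookup; tabulate-cong)
open import Function using (_∘_; Injective; Inverse)
open import Relation.Binary.PropositionalEquality using (_≡_; refl; sym; trans; cong; cong₂; subst; module ≡-Reasoning)
open import Relation.Nullary using (Dec; yes; no; contradiction)
open import Relation.Nullary.Decidable using (map′; _×-dec_; _⊎-dec_)
open import Relation.Unary using (Decidable)
open import Defs

private
  variable
    n s s′ : ℕ

-- Energy and available functions

bit : Bool → ℕ
bit b = if b then 1 else 0

energy : Gates n s → Vec Bool n → ℕ
energy gs a = count (_≟ true) (values gs a)

energy-▷ : (gs : Gates n s) (g : Gate n s) (a : Vec Bool n) →
           energy (gs ▷ g) a ≡ bit (gateValue a (values gs a) g) + energy gs a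
energy-▷ gs g a with gateValue a (values gs a) g
... | true  = refl
... | false = refl

infix 4 _⊢_ _⊢ᵍ_ _≼_

-- Speaking of available functions instead of node indices makes renumbering of gates invisible.
record _⊢_ (gs : Gates n s) (h : Vec Bool n → Bool) : Set where
  constructor _at_
  field
    node    : Node n s
    correct : ∀ a → nodeValue a (values gs a) node ≡ h a

-- h can be computed by one more gate on top of gs.
record _⊢ᵍ_ (gs : Gates n s) (h : Vec Bool n → Bool) : Set where
  constructor _at_
  field
    gate    : Gate n s
    correct : ∀ a → gateValue a (values gs a) gate ≡ h a

-- A semantic inclusion: it covers appending gates as well as merging them, where `gs` need not be a
-- prefix of `gs′`.
_≼_ : Gates n s → Gates n s′ → Set
gs ≼ gs′ = ∀ {h} → gs ⊢ h → gs′ ⊢ h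

⊢-resp : {gs : Gates n s} {h k : Vec Bool n → Bool} → (∀ a → h a ≡ k a) → gs ⊢ h → gs ⊢ k
⊢-resp eq (p at c) = p at λ a → trans (c a) (eq a)

⊢ᵍ-resp : {gs : Gates n s} {h k : Vec Bool n → Bool} → (∀ a → h a ≡ k a) → gs ⊢ᵍ h → gs ⊢ᵍ k
⊢ᵍ-resp eq (g at c) = g at λ a → trans (c a) (eq a)

⊢-input : {gs : Gates n s} (i : Fin n) → gs ⊢ λ a → lookup a i
⊢-input i = inj₁ i at λ _ → refl

⊢-node : {gs : Gates n s} (p : Node n s) → gs ⊢ λ a → nodeValue a (values gs a) p
⊢-node p = p at λ _ → refl

⊢ᵍ-∧ : {gs : Gates n s} {h k : Vec Bool n → Bool} → gs ⊢ h → gs ⊢ k → gs ⊢ᵍ λ a → h a ∧ k a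
⊢ᵍ-∧ (p at c) (q at d) = AND p q at λ a → cong₂ _∧_ (c a) (d a)

⊢ᵍ-∨ : {gs : Gates n s} {h k : Vec Bool n → Bool} → gs ⊢ h → gs ⊢ k → gs ⊢ᵍ λ a → h a ∨ k a
⊢ᵍ-∨ (p at c) (q at d) = OR p q at λ a → cong₂ _∨_ (c a) (d a)

⊢ᵍ-not : {gs : Gates n s} {h : Vec Bool n → Bool} → gs ⊢ h → gs ⊢ᵍ λ a → not (h a)
⊢ᵍ-not (p at c) = NOT p at λ a → cong not (c a)

▷-⊢ : {gs : Gates n s} {h : Vec Bool n → Bool} (d : gs ⊢ᵍ h) → gs ▷ _⊢ᵍ_.gate d ⊢ h
▷-⊢ (g at c) = inj₂ zero at c

≼-▷ : {gs : Gates n s} (g : Gate n s) → gs ≼ gs ▷ g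
≼-▷ g (inj₁ i at c) = inj₁ i at c
≼-▷ g (inj₂ j at c) = inj₂ (suc j) at c

gate-≼ : {gs : Gates n s} {gs′ : Gates n s′} → gs ≼ gs′ →
         (g : Gate n s) → gs′ ⊢ᵍ λ a → gateValue a (values gs a) g
gate-≼ ι (AND p q) = ⊢ᵍ-∧ (ι (⊢-node p)) (ι (⊢-node q))
gate-≼ ι (OR p q)  = ⊢ᵍ-∨ (ι (⊢-node p)) (ι (⊢-node q))
gate-≼ ι (NOT p)   = ⊢ᵍ-not (ι (⊢-node p))

-- Extensions with an energy budget

record Extension (gs : Gates n s) (Goal : ∀ {s′} → Gates n s′ → Set)
                 (cost : Vec Bool n → ℕ) : Set where
  field
    {size}  : ℕ
    gates   : Gates n size
    extends : gs ≼ gates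
    goal    : Goal gates
    energy≤ : ∀ a → energy gates a ≤ cost a + energy gs a

open Extension

module _ {gs : Gates n s} where

  done : {Goal : ∀ {s′} → Gates n s′ → Set} → Goal gs → Extension gs Goal (λ _ → 0)
  done g = record { gates = gs ; extends = λ d → d ; goal = g ; energy≤ = λ _ → ≤-refl }

  push : {h : Vec Bool n → Bool} → gs ⊢ᵍ h → Extension gs (_⊢ h) (bit ∘ h)
  push d@(g at c) = record
    { gates   = gs ▷ g
    ; extends = ≼-▷ g
    ; goal    = ▷-⊢ d
    ; energy≤ = λ a → ≤-reflexive
        (trans (energy-▷ gs g a) (cong (λ b → bit b + energy gs a) (c a)))
    }

  infixl 1 _then_

  _then_ : {G G′ : ∀ {s′} → Gates n s′ → Set} {c c′ : Vec Bool n → ℕ} →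
           (e : Extension gs G c) → Extension (gates e) G′ c′ →
           Extension gs G′ (λ a → c′ a + c a)
  _then_ {c = c} {c′ = c′} e e′ = record
    { gates   = gates e′
    ; extends = λ d → extends e′ (extends e d)
    ; goal    = goal e′
    ; energy≤ = λ a → begin
        energy (gates e′) a             ≤⟨ energy≤ e′ a ⟩
        c′ a + energy (gates e) a       ≤⟨ +-monoʳ-≤ (c′ a) (energy≤ e a) ⟩
        c′ a + (c a + energy gs a)      ≡⟨ +-assoc (c′ a) (c a) _ ⟨
        c′ a + c a + energy gs a        ∎
    }
    where open ≤-Reasoning

  relax : {G : ∀ {s′} → Gates n s′ → Set} {c c′ : Vec Bool n → ℕ} →
          (∀ a → c a ≤ c′ a) → Extension gs G c → Extension gs G c′
  relax c≤c′ e = record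
    { gates   = gates e
    ; extends = extends e
    ; goal    = goal e
    ; energy≤ = λ a → ≤-trans (energy≤ e a) (+-monoˡ-≤ _ (c≤c′ a))
    }

-- The tree of prefix conjunctions and its mirror image

Negated : ∀ {k} → (Fin k → Vec Bool n → Bool) → Gates n s → Set
Negated lit gs = ∀ i → gs ⊢ λ a → not (lit i a)

bit≤1 : ∀ b → bit b ≤ 1
bit≤1 true  = ≤-refl
bit≤1 false = z≤n

negations : ∀ k (lit : Fin k → Vec Bool n → Bool) {gs : Gates n s} →
            (∀ i → gs ⊢ lit i) → Extension gs (Negated lit) (λ _ → k)
negations zero lit pos = done λ ()
negations (suc k) lit pos =
  relax (λ a → +-monoˡ-≤ k (bit≤1 (not (lit zero a))))
    (rest then record { Extension last ; goal = λ where
      zero    → goal last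
      (suc i) → extends last (goal rest i) })
  where
  rest = negations k (lit ∘ suc) (pos ∘ suc)
  last = push (⊢ᵍ-not (extends rest (pos zero)))

restrict : ∀ {k} → (Fin k → Vec Bool n → Bool) → Vec Bool n → Vec Bool k
restrict lit a = tabulate λ i → lit i a

mux : ∀ p l (h : Bool → Bool) →
      ((p ∧ not l) ∧ h false) ∨ ((p ∧ l) ∧ h true) ≡ p ∧ h l
mux false l     h = refl
mux true  false h with h false
... | true  = refl
... | false = refl
mux true  true  h = refl

-- The two longer prefixes exclude each other, so at most one subtree consumes energy.
branch-cost : ∀ p l c → bit (p ∧ l) * c + bit (p ∧ not l) * c ≤ bit p * c
branch-cost false l     c = z≤n
branch-cost true  false c = ≤-refl
branch-cost true  true  c = ≤-reflexive (ℕ.+-identityʳ (1 * c))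

-- An active tree node pays 2 for itself: exactly one of its two conjunctions fires, and possibly
-- its disjunction. An inactive one pays nothing.
node-cost : ∀ p l b k →
            bit (p ∧ b) + (bit p * (2 * k) + (bit (p ∧ l) + bit (p ∧ not l))) ≤ bit p * (2 * suc k)
node-cost false l b k = z≤n
node-cost true  l b k = begin
  bit b + (1 * (2 * k) + (bit l + bit (not l))) ≡⟨ cong (λ x → bit b + (1 * (2 * k) + x)) (one l) ⟩
  bit b + (1 * (2 * k) + 1)                     ≤⟨ +-monoˡ-≤ _ (bit≤1 b) ⟩
  1 + (1 * (2 * k) + 1)                         ≡⟨ arith k ⟩
  1 * (2 * suc k)                               ∎
  where
  open ≤-Reasoning
  one : ∀ l → bit l + bit (not l) ≡ 1
  one true  = refl
  one false = refl
  arith : ∀ k → 1 + (1 * (2 * k) + 1) ≡ 1 * (2 * suc k)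
  arith = solve-∀

-- The function p says whether the current prefix agrees with the input, and
-- lit lists the variables that the prefix leaves unread.
module _ {n : ℕ} where

  tree : ∀ k (h : Vec Bool k → Bool) (lit : Fin k → Vec Bool n → Bool) (p : Vec Bool n → Bool)
         {gs : Gates n s} → gs ⊢ (λ _ → false) → (∀ i → gs ⊢ lit i) → Negated lit gs → gs ⊢ p →
         Extension gs (_⊢ λ a → p a ∧ h (restrict lit a)) (λ a → bit (p a) * (2 * k))

  -- The two longer prefixes are given and the last disjunction is not yet appended. This serves the
  -- top of the tree, where the prefixes are literals and that disjunction becomes the root of the
  -- circuit.
  branch : ∀ k (h : Vec Bool (suc k) → Bool) (lit : Fin (suc k) → Vec Bool n → Bool)
           (p : Vec Bool n → Bool) {gs : Gates n s} →
           gs ⊢ (λ _ → false) → (∀ i → gs ⊢ lit i) → Negated lit gs →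
           gs ⊢ (λ a → p a ∧ not (lit zero a)) → gs ⊢ (λ a → p a ∧ lit zero a) →
           Extension gs (_⊢ᵍ λ a → p a ∧ h (restrict lit a)) (λ a → bit (p a) * (2 * k))

  -- A leaf adds no gate: it is the prefix itself or the constant 0.
  tree zero h lit p 𝟘 pos neg ⊢p with h []
  ... | true  = relax (λ _ → z≤n) (done (⊢-resp (λ a → sym (∧-identityʳ (p a))) ⊢p))
  ... | false = relax (λ _ → z≤n) (done (⊢-resp (λ a → sym (∧-zeroʳ (p a))) 𝟘))
  tree (suc k) h lit p 𝟘 pos neg ⊢p =
    relax (λ a → node-cost (p a) (lit zero a) (h (restrict lit a)) k)
      ((e₀ then e₁) then e₂ then push (goal e₂))
    where
    e₀ = push (⊢ᵍ-∧ ⊢p (neg zero))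
    e₁ = push (⊢ᵍ-∧ (extends e₀ ⊢p) (extends e₀ (pos zero)))
    ι = λ {f} d → extends e₁ {f} (extends e₀ d)
    e₂ = branch k h lit p (ι 𝟘) (ι ∘ pos) (ι ∘ neg) (extends e₁ (goal e₀)) (goal e₁)

  branch k h lit p 𝟘 pos neg ⊢p₀ ⊢p₁ =
    relax (λ a → branch-cost (p a) (lit zero a) (2 * k))
      (e₀ then e₁ then done
        (⊢ᵍ-resp (λ a → mux (p a) (lit zero a) (λ b → h (b ∷ restrict (lit ∘ suc) a)))
          (⊢ᵍ-∨ (extends e₁ (goal e₀)) (goal e₁))))
    where
    e₀ = tree k (h ∘ (false ∷_)) (lit ∘ suc) _ 𝟘 (pos ∘ suc) (neg ∘ suc) ⊢p₀
    ι = λ {f} → extends e₀ {f}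
    e₁ = tree k (h ∘ (true ∷_)) (lit ∘ suc) _ (ι 𝟘) (ι ∘ pos ∘ suc) (ι ∘ neg ∘ suc) (ι ⊢p₁)

-- A circuit within the bound

maxOverInputs-lub : ∀ n {h : Vec Bool n → ℕ} {m} → (∀ a → h a ≤ m) → maxOverInputs n h ≤ m
maxOverInputs-lub zero    h≤m = h≤m []
maxOverInputs-lub (suc n) h≤m =
  ⊔-lub (maxOverInputs-lub n (h≤m ∘ (false ∷_))) (maxOverInputs-lub n (h≤m ∘ (true ∷_)))

≤maxOverInputs : ∀ {n} (h : Vec Bool n → ℕ) a → h a ≤ maxOverInputs n h
≤maxOverInputs h []          = ≤-refl
≤maxOverInputs h (false ∷ a) = ≤-trans (≤maxOverInputs (h ∘ (false ∷_)) a) (m≤m⊔n _ _)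
≤maxOverInputs h (true ∷ a)  = ≤-trans (≤maxOverInputs (h ∘ (true ∷_)) a) (m≤n⊔m _ _)

circuit≤3n∸1 : ∀ m (f : Vec Bool (suc m) → Bool) →
               ∃[ C ] (C Computes f × EC C ≤ 3 * suc m ∸ 1)
circuit≤3n∸1 m f =
  circuit (gates e ▷ gate)
  , (λ a → trans (correct a) (cong f (tabulate∘lookup a)))
  , maxOverInputs-lub (suc m) λ a → begin
      energy (gates e ▷ gate) a                       ≡⟨ energy-▷ (gates e) gate a ⟩
      bit (gateValue a (values (gates e) a) gate) + energy (gates e) a
                                                      ≤⟨ +-mono-≤ (bit≤1 (gateValue a (values (gates e) a) gate)) (energy≤ e a) ⟩
      -- In order: the root, two per level below the top, the constant gate, the negations, and the
      -- empty circuit.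
      1 + (1 * (2 * m) + (0 + suc m) + 0)             ≡⟨ arith m ⟩
      m + (suc m + (suc m + 0))                       ∎
  where
  open ≤-Reasoning
  var : Fin (suc m) → Vec Bool (suc m) → Bool
  var i a = lookup a i
  e₀ = negations (suc m) var {[]} ⊢-input
  e₁ = relax (λ a → ≤-reflexive (cong bit (∧-inverseʳ (var zero a))))
         (push (⊢ᵍ-∧ (⊢-input zero) (goal e₀ zero)))
  neg = λ i → extends e₁ (goal e₀ i)
  -- The empty prefix is constantly true and needs no node; its two extensions are the literals of
  -- the first variable.
  e₂ = branch m f var (λ _ → true)
         (⊢-resp (λ a → ∧-inverseʳ (var zero a)) (goal e₁)) ⊢-input neg (neg zero) (⊢-input zero)
  e = e₀ then e₁ then e₂
  open _⊢ᵍ_ (goal e)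
  arith : ∀ m → 1 + (1 * (2 * m) + (0 + suc m) + 0) ≡ m + (suc m + (suc m + 0))
  arith = solve-∀

-- Coding Boolean functions

toBool : Fin 2 → Bool
toBool = Inverse.to 2↔Bool

fromBool : Bool → Fin 2
fromBool = Inverse.from 2↔Bool

toBool-fromBool : ∀ b → toBool (fromBool b) ≡ b
toBool-fromBool b = Inverse.inverseˡ 2↔Bool refl

decode : Fin (2 ^ n) → Vec Bool n
decode k = tabulate (toBool ∘ finToFun k)

decode-surjective : (a : Vec Bool n) → ∃[ k ] decode k ≡ a
decode-surjective a = funToFin digits , (begin
  tabulate (toBool ∘ finToFun (funToFin digits)) ≡⟨ tabulate-cong (λ i → cong toBool (finToFun-funToFin digits i)) ⟩
  tabulate (toBool ∘ digits)                     ≡⟨ tabulate-cong (λ i → toBool-fromBool (lookup a i)) ⟩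
  tabulate (lookup a)                            ≡⟨ tabulate∘lookup a ⟩
  a                                              ∎)
  where
  open ≡-Reasoning
  digits = fromBool ∘ lookup a

agree-on-codes : {h k : Vec Bool n → Bool} → (∀ i → h (decode i) ≡ k (decode i)) → ∀ a → h a ≡ k a
agree-on-codes eq a with decode-surjective a
... | i , refl = eq i

-- The truth table, read as a number in binary.
code : (Vec Bool n → Bool) → Fin (2 ^ (2 ^ n))
code h = funToFin (fromBool ∘ h ∘ decode)

code-injective : {h k : Vec Bool n → Bool} → code h ≡ code k → ∀ a → h a ≡ k a
code-injective {h = h} {k} eq = agree-on-codes λ i → begin
  h (decode i)                                          ≡⟨ digit h i ⟨
  toBool (finToFun (code h) i)                          ≡⟨ cong (λ c → toBool (finToFun c i)) eq ⟩
  toBool (finToFun (code k) i)                          ≡⟨ digit k i ⟩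
  k (decode i)                                          ∎
  where
  open ≡-Reasoning
  digit : (h : Vec Bool _ → Bool) → ∀ i → toBool (finToFun (code h) i) ≡ h (decode i)
  digit h i = trans (cong toBool (finToFun-funToFin (fromBool ∘ h ∘ decode) i)) (toBool-fromBool _)

computes? : (C : Circuit n) (f : Vec Bool n → Bool) → Dec (C Computes f)
computes? C f = map′ agree-on-codes (λ eq i → eq (decode i))
  (all? λ i → output C (decode i) ≟ f (decode i))

-- Merging equal gates

gateCode : (gs : Gates n s) → Fin s → Fin (2 ^ (2 ^ n))
gateCode gs i = code λ a → lookup (values gs a) i

-- By the pigeonhole principle, `distinct` bounds `size` by the number of Boolean functions.
record Merged (gs : Gates n s) : Set where
  field
    {size}   : ℕ
    gates    : Gates n size
    extends  : gs ≼ gates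
    distinct : Injective _≡_ _≡_ (gateCode gates)
    energy≤  : ∀ a → energy gates a ≤ energy gs a

▷-≼ : {gs : Gates n s} {gs′ : Gates n s′} {g : Gate n s} →
      gs ≼ gs′ → gs′ ⊢ (λ a → gateValue a (values gs a) g) → gs ▷ g ≼ gs′
▷-≼ ι d (inj₁ i at c)       = ⊢-resp c (ι (⊢-input i))
▷-≼ ι d (inj₂ zero at c)    = ⊢-resp c d
▷-≼ ι d (inj₂ (suc j) at c) = ι (inj₂ j at c)

-- Each gate in turn is rewired to the merged gates. If its function is already present it is
-- dropped, which removes its bit from the energy; otherwise it is appended, with the same bit as
-- before.
merge : (gs : Gates n s) → Merged gs
merge [] = record
  { gates = [] ; extends = λ d → d ; distinct = λ { {()} } ; energy≤ = λ _ → ≤-refl }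
merge {n} (gs ▷ g) with merge gs
... | record { gates = gs′ ; extends = ι ; distinct = inj ; energy≤ = en }
  with gate-≼ ι g
... | g′ at c
  with any? (λ i → gateCode gs′ i Fin.≟ code (λ a → gateValue a (values gs′ a) g′))
... | yes (i , eq) = record
  { gates    = gs′
  ; extends  = ▷-≼ ι (inj₂ i at λ a → trans (code-injective eq a) (c a))
  ; distinct = inj
  ; energy≤  = λ a → ≤-trans (en a) (≤-trans (ℕ.m≤n+m _ _) (≤-reflexive (sym (energy-▷ gs g a))))
  }
... | no new = record
  { gates    = gs′ ▷ g′
  ; extends  = ▷-≼ (λ d → ≼-▷ g′ (ι d)) (▷-⊢ (g′ at c))
  ; distinct = λ
      { {zero}  {zero}  eq → refl
      ; {zero}  {suc j} eq → contradiction (j , sym eq) new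
      ; {suc i} {zero}  eq → contradiction (i , eq) new
      ; {suc i} {suc j} eq → cong suc (inj eq)
      }
  ; energy≤  = λ a → begin
      energy (gs′ ▷ g′) a                                    ≡⟨ energy-▷ gs′ g′ a ⟩
      bit (gateValue a (values gs′ a) g′) + energy gs′ a     ≡⟨ cong (λ b → bit b + energy gs′ a) (c a) ⟩
      bit (gateValue a (values gs a) g) + energy gs′ a       ≤⟨ +-monoʳ-≤ (bit (gateValue a (values gs a) g)) (en a) ⟩
      bit (gateValue a (values gs a) g) + energy gs a        ≡⟨ energy-▷ gs g a ⟨
      energy (gs ▷ g) a                                      ∎
  }
  where open ≤-Reasoning

-- Here `s` counts the gates below the root; bounding it makes the property decidable.
SmallCircuitWithEC : (Vec Bool n → Bool) → ℕ → Set
SmallCircuitWithEC {n} f m =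
  ∃[ s ] (s < suc (2 ^ (2 ^ n)) × ∃[ gs ] (circuit {n} {s} gs Computes f × EC (circuit gs) ≡ m))

-- Only the gates below the root are merged. The root is rewired and kept, since the output must be
-- the last gate. The energy does not rise on any single input, hence neither does the maximum.
shrink : (f : Vec Bool n → Bool) (C : Circuit n) → C Computes f →
         ∃[ m ] (m ≤ EC C × SmallCircuitWithEC f m)
shrink {n} f (circuit (gs ▷ g)) comp =
  EC (circuit (M.gates ▷ gate))
  , maxOverInputs-lub n (λ a → ≤-trans (step a) (≤maxOverInputs (energy (gs ▷ g)) a))
  , _ , s≤s (injective⇒≤ M.distinct) , M.gates ▷ gate , (λ a → trans (correct a) (comp a)) , refl
  where
  module M = Merged (merge gs)
  open _⊢ᵍ_ (gate-≼ M.extends g)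
  open ≤-Reasoning
  step : ∀ a → energy (M.gates ▷ gate) a ≤ energy (gs ▷ g) a
  step a = begin
    energy (M.gates ▷ gate) a                                    ≡⟨ energy-▷ M.gates gate a ⟩
    bit (gateValue a (values M.gates a) gate) + energy M.gates a   ≤⟨ +-mono-≤ (≤-reflexive (cong bit (correct a))) (M.energy≤ a) ⟩
    bit (gateValue a (values gs a) g) + energy gs a            ≡⟨ energy-▷ gs g a ⟨
    energy (gs ▷ g) a                                          ∎

-- Exhaustive search

-- Finiteness in the form of omniscience: it passes to sums, products and surjective images without
-- listing elements.
Searchable : Set → Set₁
Searchable A = {P : A → Set} → Decidable P → Dec (∃ P)

search-⊎ : {A B : Set} → Searchable A → Searchable B → Searchable (A ⊎ B)
search-⊎ sA sB P? = map′
  [ (λ (a , pa) → inj₁ a , pa) , (λ (b , pb) → inj₂ b , pb) ]′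
  (λ { (inj₁ a , pa) → inj₁ (a , pa) ; (inj₂ b , pb) → inj₂ (b , pb) })
  (sA (P? ∘ inj₁) ⊎-dec sB (P? ∘ inj₂))

search-× : {A B : Set} → Searchable A → Searchable B → Searchable (A × B)
search-× sA sB P? = map′
  (λ (a , b , p) → (a , b) , p) (λ ((a , b) , p) → a , b , p)
  (sA λ a → sB λ b → P? (a , b))

search-onto : {A B : Set} (f : A → B) → (∀ b → ∃[ a ] f a ≡ b) → Searchable A → Searchable B
search-onto f onto sA {P} P? = map′
  (λ (a , p) → f a , p)
  (λ (b , p) → proj₁ (onto b) , subst P (sym (proj₂ (onto b))) p)
  (sA (P? ∘ f))

search-Gate : Searchable (Gate n s)
search-Gate = search-onto
  [ (λ (p , q) → AND p q) , [ (λ (p , q) → OR p q) , NOT ]′ ]′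
  (λ where
    (AND p q) → inj₁ (p , q) , refl
    (OR p q)  → inj₂ (inj₁ (p , q)) , refl
    (NOT p)   → inj₂ (inj₂ p) , refl)
  (search-⊎ (search-× node node) (search-⊎ (search-× node node) node))
  where
  node : Searchable (Node _ _)
  node = search-⊎ any? any?

search-Gates : ∀ s → Searchable (Gates n s)
search-Gates zero    P? = map′ ([] ,_) (λ { ([] , p) → p }) (P? [])
search-Gates (suc s) = search-onto (λ (gs , g) → gs ▷ g) (λ { (gs ▷ g) → (gs , g) , refl })
  (search-× (search-Gates s) search-Gate)

smallCircuitWithEC? : (f : Vec Bool n → Bool) → Decidable (SmallCircuitWithEC f)
smallCircuitWithEC? f m = anyUpTo?
  (λ s → search-Gates (suc s) λ gs → computes? (circuit gs) f ×-dec EC (circuit gs) ℕ.≟ m) _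

-- The minimum is attained

least : {Q : ℕ → Set} → Decidable Q → ∀ m → Q m → ∃[ k ] (IsMinimum Q k × k ≤ m)
least Q? zero    q = 0 , (q , λ _ _ → z≤n) , z≤n
least Q? (suc m) q with Q? 0
... | yes q₀ = 0 , (q₀ , λ _ _ → z≤n) , z≤n
-- Shifting the predicate by one lowers the known witness, so the search ends.
... | no ¬q₀ with least (Q? ∘ suc) m q
...   | k , (qk , min) , k≤m =
        suc k , (qk , λ { zero q₀ → contradiction q₀ ¬q₀ ; (suc j) qj → s≤s (min j qj) }) , s≤s k≤m

EC-attained : (f : Vec Bool n → Bool) (C : Circuit n) → C Computes f → ∃[ k ] (IsEC f k × k ≤ EC C)
EC-attained f C comp =
  let m , m≤ , small                                  = shrink f C comp
      k , ((s , _ , gs , comp′ , ec) , min) , k≤m     = least (smallCircuitWithEC? f) m small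
  in k
   , ((circuit gs , comp′ , ec)
     , λ { _ (C′ , comp″ , refl) →
           -- A competitor of any size shrinks to a small circuit of no greater energy, so
           -- minimality among small circuits suffices.
           let m′ , m′≤ , small′ = shrink f C′ comp″ in ≤-trans (min m′ small′) m′≤ })
   , ≤-trans k≤m m≤

proposition2p2 : (n : ℕ) → n ≥ 1 → (f : Vec Bool n → Bool) → ∃[ k ] (IsEC f k × k ≤ 3 * n ∸ 1)
proposition2p2 (suc m) _ f =
  let C , comp , EC≤ = circuit≤3n∸1 m f
      k , isEC , k≤  = EC-attained f C comp
  in k , isEC , ≤-trans k≤ EC≤
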